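{- Let $k\ge 1$ and $n\ge 2k+2$. Then every extremal graph for $\{S_{k+2},P_{2k+1}\}$ on $n$ vertices (i.e., every $n$-vertex graph containing neither $S_{k+2}$ nor $P_{2k+1}$ as a subgraph and having the maximum possible number of edges among such graphs) has all of its connected components of order at most $2k$.
   Context: Graphs are finite and simple. $S_{k+2}=K_{1,k+1}$ is the star on $k+2$ vertices and $P_{2k+1}$ is the path on $2k+1$ vertices. -}

module Defs where

open import Data.Nat using (ℕ; zero; suc; _+_; _*_; _≤_; _<_)
open import Data.Bool using (Bool; true; false)
open import Data.Fin using (Fin; toℕ; inject₁) renaming (suc to fsuc)
open import Data.List using (List; length; filter; allFin; concatMap)
open import Data.Product using (Σ; ∃; _×_; _,_)
open import Relation.Binary.PropositionalEquality using (_≡_)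
open import Relation.Nullary using (¬_)
open import Function.Definitions using (Injective)
open import Data.Nat.Properties using (_<?_)

record Graph (n : ℕ) : Set where
  field
    adj   : Fin n → Fin n → Bool
    sym   : ∀ i j → adj i j ≡ adj j i
    irrefl : ∀ i → adj i i ≡ false
open Graph public

Adj : ∀ {n} → Graph n → Fin n → Fin n → Set
Adj G i j = adj G i j ≡ true

edgePairs : ∀ {n} → Graph n → List (Fin n × Fin n)
edgePairs {n} G =
  concatMap (λ i → concatMap (λ j → pick i j (toℕ i <? toℕ j) (adj G i j)) (allFin n)) (allFin n)
  where
    open import Relation.Nullary using (Dec; yes; no)
    open import Data.List using ([]; [_])
    pick : ∀ i j → Dec (toℕ i < toℕ j) → Bool → List (Fin n × Fin n)
    pick i j (yes _) true = [ (i , j) ]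
    pick i j _ _ = []

edgeCount : ∀ {n} → Graph n → ℕ
edgeCount G = length (edgePairs G)

-- G contains the star K_{1,ℓ} (ℓ leaves) as a (not necessarily induced) subgraph:
-- a center v and ℓ distinct vertices adjacent to v (automatically ≠ v).
ContainsStar : ∀ {n} → ℕ → Graph n → Set
ContainsStar {n} ℓ G =
  Σ (Fin n) λ v → Σ (Fin ℓ → Fin n) λ f → Injective _≡_ _≡_ f × (∀ i → Adj G v (f i))

ContainsPath : ∀ {n} → ℕ → Graph n → Set
ContainsPath {n} m G =
  Σ (Fin m → Fin n) λ p → Injective _≡_ _≡_ p ×
    (∀ (i j : Fin m) → suc (toℕ i) ≡ toℕ j → Adj G (p i) (p j))

-- G is {S_{k+2}, P_{2k+1}}-free, where S_{k+2} = K_{1,k+1}.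
Free : ∀ {n} → ℕ → Graph n → Set
Free k G = ¬ ContainsStar (suc k) G × ¬ ContainsPath (suc (2 * k)) G

Extremal : ∀ {n} → ℕ → Graph n → Set
Extremal {n} k G = Free k G × (∀ (H : Graph n) → Free k H → edgeCount H ≤ edgeCount G)

data Connected {n} (G : Graph n) : Fin n → Fin n → Set where
  here : ∀ {v} → Connected G v v
  step : ∀ {u v w} → Adj G u v → Connected G v w → Connected G u w

ComponentOrder≤ : ∀ {n} → Graph n → Fin n → ℕ → Set
ComponentOrder≤ {n} G v b =
  ∀ (m : ℕ) (f : Fin m → Fin n) → Injective _≡_ _≡_ f → (∀ i → Connected G v (f i)) → m ≤ b

{-# OPTIONS --safe #-}
module Submission where

-- Write Σ for the degree sum. For k ≥ 2 and n ≥ 2k + 2 one can split n into orders between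
-- k + 1 and 2k, at most one of which has odd product with k; a disjoint union of near-k-regular
-- graphs of these orders is free and has Σ ≥ kn − 1. An extremal graph therefore has Σ ≥ kn − 1
-- and maximum degree at most k: all degrees are k except possibly one, at a vertex w, which is
-- k − 1 (and parity excludes w when k = 2). In a component of order above 2k every path on at
-- most 2k vertices can then be extended. If its ends differ from w, their degrees sum to 2k and
-- Ore's crossing argument closes the path, up to reordering, into a cycle, which some edge leaves;
-- if an end is w, which has degree at least 2, a rotation first moves w into the interior.
-- So the component contains P_{2k+1}. For k = 1 the degree condition on the component is trivial.

open import Defs
open import Data.Nat using (ℕ; zero; suc; _+_; _*_; _≤_; _<_; z≤n; s≤s; s≤s⁻¹; _≤?_)
open import Data.Nat.DivMod using (_/_; _%_; m≡m%n+[m/n]*n; m%n<n)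
open import Data.Nat.Properties hiding (_≟_)
open import Data.Nat.Tactic.RingSolver using (solve-∀)
open import Data.Bool using (Bool; true; false; _∧_; _∨_; if_then_else_)
import Data.Bool.Properties as Bool
open import Data.Fin using (Fin; zero; suc; toℕ; inject₁; inject≤; _≟_; _↑ˡ_; _↑ʳ_; splitAt; join)
import Data.Fin.Properties as Fin
open import Data.List using (List; []; _∷_; length; filter; allFin; concatMap; tabulate; lookup; _++_)
open import Data.List.Properties using (length-++; length-tabulate)
open import Data.List.Membership.Propositional using (_∈_; _∉_; find; lose)
open import Data.List.Membership.Propositional.Properties using (∈-filter⁺; ∈-filter⁻; ∈-allFin; ∈-lookup; ∈-tabulate⁻; ∈-++⁺ˡ; ∈-length)
import Data.List.Membership.DecPropositional as DecMembership
open import Data.List.Relation.Unary.Any as Any using (here; there)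
open import Data.List.Relation.Unary.Any.Properties using (lookup-index)
open import Data.List.Relation.Unary.All as All using (All; []; _∷_)
open import Data.List.Relation.Unary.All.Properties using (¬Any⇒All¬)
open import Data.List.Relation.Unary.AllPairs using ([]; _∷_)
open import Data.List.Relation.Unary.Unique.Propositional using (Unique)
open import Data.List.Relation.Unary.Unique.Propositional.Properties using (allFin⁺; filter⁺; tabulate⁺)
open import Data.List.Relation.Binary.Permutation.Propositional using (_↭_; ↭-refl; ↭-sym; ↭-trans; ↭-reflexive; ↭⇒↭ₛ; prep)
open import Data.List.Relation.Binary.Permutation.Propositional.Properties using (∈-resp-↭; All-resp-↭; ↭-length; ++⁺ˡ; ++⁺ʳ; ++-comm; ∷↭∷ʳ)
open import Data.List.Relation.Binary.Permutation.Setoid.Properties using (Unique-resp-↭)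
open import Data.Product using (∃; ∃₂; _×_; _,_; proj₁; proj₂)
open import Data.Sum using (_⊎_; inj₁; inj₂)
open import Data.Empty using (⊥; ⊥-elim)
open import Function using (_∘_; id)
open import Function.Definitions using (Injective)
open import Relation.Nullary using (¬_; Dec; yes; no; does; contradiction)
open import Relation.Nullary.Decidable using (dec-true; dec-false; decidable-stable; ¬?; _×-dec_)
open import Relation.Binary.PropositionalEquality using (_≡_; _≢_; refl; trans; cong; cong₂; subst; subst₂; setoid; module ≡-Reasoning) renaming (sym to ≡-sym)
open import Algebra.Properties.CommutativeMonoid.Sum +-0-commutativeMonoid using (sum; sum-cong-≗; ∑-distrib-+; ∑-comm)

private
  variable
    n : ℕ
    A : Set

-- Sums over Fin n

sum-mono-≤ : {f g : Fin n → ℕ} → (∀ i → f i ≤ g i) → sum f ≤ sum g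
sum-mono-≤ {zero}  f≤g = z≤n
sum-mono-≤ {suc n} f≤g = +-mono-≤ (f≤g zero) (sum-mono-≤ (f≤g ∘ suc))

sum-const : ∀ n k → sum {n} (λ _ → k) ≡ n * k
sum-const zero    k = refl
sum-const (suc n) k = cong (k +_) (sum-const n k)

sum-+ : ∀ a b (f : Fin (a + b) → ℕ) →
        sum f ≡ sum (λ i → f (i ↑ˡ b)) + sum (λ i → f (a ↑ʳ i))
sum-+ zero    b f = refl
sum-+ (suc a) b f =
  trans (cong (f zero +_) (sum-+ a b (f ∘ suc))) (≡-sym (+-assoc (f zero) _ _))

ι : Bool → ℕ
ι true  = 1
ι false = 0

δ : Fin n → Fin n → ℕ
δ i j = ι (does (i ≟ j))

δ-refl : (i : Fin n) → δ i i ≡ 1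
δ-refl i = cong ι (dec-true (i ≟ i) refl)

δ-≢ : {i j : Fin n} → i ≢ j → δ i j ≡ 0
δ-≢ {i = i} {j} i≢j = cong ι (dec-false (i ≟ j) i≢j)

sum-0 : ∀ n → sum {n} (λ _ → 0) ≡ 0
sum-0 n = trans (sum-const n 0) (*-zeroʳ n)

sum-δ : (u : Fin n) → sum (λ i → δ i u) ≡ 1
sum-δ {suc n} zero    = cong suc (sum-0 n)
sum-δ {suc n} (suc u) = sum-δ u

sum-*ˡ : ∀ c (f : Fin n → ℕ) → sum (λ i → c * f i) ≡ c * sum f
sum-*ˡ {zero}  c f = ≡-sym (*-zeroʳ c)
sum-*ˡ {suc n} c f = trans (cong (c * f zero +_) (sum-*ˡ c (f ∘ suc)))
                           (≡-sym (*-distribˡ-+ c (f zero) _))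

module _ {k : ℕ} {g : Fin n → ℕ} (g≤k : ∀ i → g i ≤ k) where

  bump-≤ : ∀ {u} → g u < k → ∀ i → g i + δ i u ≤ k
  bump-≤ {u} gu<k i with i ≟ u
  ... | yes refl = subst (_≤ k) (+-comm 1 (g i)) gu<k
  ... | no _     = subst (_≤ k) (≡-sym (+-identityʳ (g i))) (g≤k i)

  sum-bump : ∀ u → sum (λ i → g i + δ i u) ≡ suc (sum g)
  sum-bump u = trans (∑-distrib-+ g (λ i → δ i u))
                     (trans (cong (sum g +_) (sum-δ u)) (+-comm (sum g) 1))

  -- If some entry were below `k`, raising it by one would respect the bound `k` and push the total
  -- above `n * k`.
  sum-max : n * k ≤ sum g → ∀ i → k ≤ g i
  sum-max full i = ≮⇒≥ λ gi<k → <⇒≱ (≤-reflexive (≡-sym (sum-bump i)))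
    (≤-trans (sum-mono-≤ (bump-≤ gi<k)) (subst (_≤ sum g) (≡-sym (sum-const n k)) full))

  -- The room at `u` is recorded as a bound on a bumped function, so that the lemma can be iterated.
  sum-slack : sum g < n * k → ∃ λ u → ∀ i → g i + δ i u ≤ k
  sum-slack lt with Fin.any? (λ u → suc (g u) ≤? k)
  ... | yes (u , gu<k) = u , bump-≤ gu<k
  ... | no  none = contradiction lt (≤⇒≯ (subst (_≤ sum g) (sum-const n k)
        (sum-mono-≤ λ i → ≮⇒≥ λ gi<k → none (i , gi<k))))

-- The two vertices may coincide.
sum-slack₂ : ∀ {k} {g : Fin n → ℕ} → (∀ i → g i ≤ k) → suc (sum g) < n * k →
             ∃₂ λ u v → ∀ i → g i + δ i u + δ i v ≤ k
sum-slack₂ {n = n} {k} g≤k lt =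
  let u , g≤k′ = sum-slack g≤k (<-trans (n<1+n _) lt)
      v , g≤k″ = sum-slack g≤k′ (subst (_< n * k) (≡-sym (sum-bump g≤k u)) lt)
  in u , v , g≤k″

-- Counting in duplicate-free lists

index-injective : {xs : List A} {x y : A} (p : x ∈ xs) (q : y ∈ xs) →
                  Any.index p ≡ Any.index q → x ≡ y
index-injective {xs = xs} p q eq =
  trans (lookup-index p) (trans (cong (lookup xs) eq) (≡-sym (lookup-index q)))

lookup-injective : {xs : List A} → Unique xs → Injective _≡_ _≡_ (lookup xs)
lookup-injective (_ ∷ _)   {zero}  {zero}  eq = refl
lookup-injective (x∉ ∷ _)  {zero}  {suc j} eq = contradiction eq (All.lookup x∉ (∈-lookup j))
lookup-injective (x∉ ∷ _)  {suc i} {zero}  eq = contradiction (≡-sym eq) (All.lookup x∉ (∈-lookup i))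
lookup-injective (_ ∷ xs!) {suc i} {suc j} eq = cong suc (lookup-injective xs! eq)

-- Pigeonhole: sending each position of `xs` to a position of the same element in `ys` is injective.
unique-⊆-length : {xs ys : List A} → Unique xs → (∀ {x} → x ∈ xs → x ∈ ys) →
                  length xs ≤ length ys
unique-⊆-length {xs = xs} xs! xs⊆ys = Fin.injective⇒≤
  {f = λ i → Any.index (xs⊆ys (∈-lookup {xs = xs} i))}
  (λ {i} {j} eq → lookup-injective xs! (index-injective (xs⊆ys (∈-lookup i)) (xs⊆ys (∈-lookup j)) eq))

_∈?_ : (x : Fin n) (xs : List (Fin n)) → Dec (x ∈ xs)
_∈?_ = DecMembership._∈?_ _≟_

∈-or-∉ : (xs ys : List (Fin n)) → (∃ λ x → x ∈ xs × x ∉ ys) ⊎ (∀ {x} → x ∈ xs → x ∈ ys)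
∈-or-∉ xs ys with Any.any? (λ x → ¬? (x ∈? ys)) xs
... | yes p = inj₁ (find p)
... | no ¬p = inj₂ λ {x} x∈xs → decidable-stable (x ∈? ys) λ x∉ys → ¬p (lose x∈xs x∉ys)

exists-∉ : {xs ys : List (Fin n)} → Unique xs → length ys < length xs → ∃ λ x → x ∈ xs × x ∉ ys
exists-∉ {xs = xs} {ys} xs! lt with ∈-or-∉ xs ys
... | inj₁ p     = p
... | inj₂ xs⊆ys = contradiction (unique-⊆-length xs! xs⊆ys) (<⇒≱ lt)

count : (A → Bool) → List A → ℕ
count f xs = length (filter (λ x → f x Bool.≟ true) xs)

count-∷ : ∀ (f : A → Bool) x xs → count f (x ∷ xs) ≡ ι (f x) + count f xs
count-∷ f x xs with f x
... | true  = refl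
... | false = refl

count-tabulate : ∀ (f : A → Bool) (g : Fin n → A) → count f (tabulate g) ≡ sum (λ i → ι (f (g i)))
count-tabulate {n = zero}  f g = refl
count-tabulate {n = suc n} f g =
  trans (count-∷ f (g zero) _) (cong (ι (f (g zero)) +_) (count-tabulate f (g ∘ suc)))

-- Degrees and the handshake lemma

nbrs : Graph n → Fin n → List (Fin n)
nbrs {n} G i = filter (λ j → adj G i j Bool.≟ true) (allFin n)

deg : Graph n → Fin n → ℕ
deg G i = length (nbrs G i)

∈-nbrs⁺ : (G : Graph n) {i j : Fin n} → Adj G i j → j ∈ nbrs G i
∈-nbrs⁺ G {i} {j} = ∈-filter⁺ _ (∈-allFin j)

∈-nbrs⁻ : (G : Graph n) {i j : Fin n} → j ∈ nbrs G i → Adj G i j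
∈-nbrs⁻ {n} G j∈ = proj₂ (∈-filter⁻ _ {xs = allFin n} j∈)

nbrs-unique : (G : Graph n) (i : Fin n) → Unique (nbrs G i)
nbrs-unique {n} G i = filter⁺ _ (allFin⁺ n)

Adj-sym : (G : Graph n) {i j : Fin n} → Adj G i j → Adj G j i
Adj-sym G {i} {j} a = trans (sym G j i) a

Adj⇒≢ : (G : Graph n) {i j : Fin n} → Adj G i j → i ≢ j
Adj⇒≢ G {i} a refl = contradiction (trans (≡-sym a) (irrefl G i)) λ ()

deg-sum : (G : Graph n) (i : Fin n) → deg G i ≡ sum (λ j → ι (adj G i j))
deg-sum G i = count-tabulate (adj G i) id

deg≤⇒¬star : (G : Graph n) (k : ℕ) → (∀ i → deg G i ≤ k) → ¬ ContainsStar (suc k) G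
deg≤⇒¬star G k deg≤k (v , f , f-inj , f-adj) = <⇒≱ k<deg (deg≤k v)
  where
  leaf : ∀ {x} → x ∈ tabulate f → x ∈ nbrs G v
  leaf x∈ with ∈-tabulate⁻ {f = f} x∈
  ... | i , refl = ∈-nbrs⁺ G (f-adj i)
  k<deg : k < deg G v
  k<deg = subst (_≤ deg G v) (length-tabulate f) (unique-⊆-length (tabulate⁺ f-inj) leaf)

¬star⇒deg≤ : (G : Graph n) (k : ℕ) → ¬ ContainsStar (suc k) G → ∀ i → deg G i ≤ k
¬star⇒deg≤ G k ¬star i = ≮⇒≥ λ k<deg → ¬star
  ( i
  , (λ j → lookup (nbrs G i) (inject≤ j k<deg))
  , (λ eq → Fin.inject≤-injective _ _ _ _ (lookup-injective (nbrs-unique G i) eq))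
  , (λ j → ∈-nbrs⁻ G (∈-lookup (inject≤ j k<deg))))

-- `allFin n` is `tabulate id`, and a general `g` lets the induction pass to its tail.
length-concatMap : (f : Fin n → List A) {m : ℕ} (g : Fin m → Fin n) →
                   length (concatMap f (tabulate g)) ≡ sum (λ i → length (f (g i)))
length-concatMap f {zero}  g = refl
length-concatMap f {suc m} g =
  trans (length-++ (f (g zero))) (cong (length (f (g zero)) +_) (length-concatMap f (g ∘ suc)))

-- The cells of edgePairs are given by a function local to its definition, so they are
-- recovered by unification.
concatMap-fun : {B : Set} (xs : List A) {f : A → List B} (ys : List B) → ys ≡ concatMap f xs → A → List B
concatMap-fun _ {f} _ _ = f

cell : Graph n → Fin n → Fin n → List (Fin n × Fin n)
cell {n} G i = concatMap-fun (allFin n) (concatMap-fun (allFin n) (edgePairs G) refl i) refl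

upper : Graph n → Fin n → Fin n → ℕ
upper G i j with toℕ i <? toℕ j
... | yes _ = ι (adj G i j)
... | no _  = 0

length-cell : (G : Graph n) (i j : Fin n) → length (cell G i j) ≡ upper G i j
length-cell G i j with toℕ i <? toℕ j
... | no _  = refl
... | yes _ with adj G i j
...   | true  = refl
...   | false = refl

edgeCount-sum : (G : Graph n) → edgeCount G ≡ sum (λ i → sum (upper G i))
edgeCount-sum G = trans (length-concatMap (λ i → concatMap (cell G i) (allFin _)) id)
  (sum-cong-≗ λ i → trans (length-concatMap (cell G i) id) (sum-cong-≗ (length-cell G i)))

-- Off the diagonal exactly one of the cells (i, j) and (j, i) lies above it; on the diagonal
-- irreflexivity makes everything vanish.
upper-sym : (G : Graph n) (i j : Fin n) → ι (adj G i j) ≡ upper G i j + upper G j i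
upper-sym G i j with toℕ i <? toℕ j | toℕ j <? toℕ i
... | yes i<j | yes j<i = contradiction j<i (<-asym i<j)
... | yes _   | no _    = ≡-sym (+-identityʳ _)
... | no _    | yes _   = cong ι (sym G i j)
... | no i≮j  | no j≮i with Fin.toℕ-injective (≤-antisym (≮⇒≥ j≮i) (≮⇒≥ i≮j))
...   | refl = cong ι (irrefl G i)

-- By `upper-sym` the adjacency matrix is its upper triangle plus the transpose; exchanging the sums
-- shows that both have total `edgeCount G`.
handshake : (G : Graph n) → sum (deg G) ≡ 2 * edgeCount G
handshake G = begin
  sum (deg G)                                          ≡⟨ sum-cong-≗ (deg-sum G) ⟩
  sum (λ i → sum (λ j → ι (adj G i j)))                ≡⟨ sum-cong-≗ (λ i → trans (sum-cong-≗ (upper-sym G i)) (∑-distrib-+ (upper G i) (λ j → upper G j i))) ⟩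
  sum (λ i → sum (upper G i) + sum (λ j → upper G j i)) ≡⟨ ∑-distrib-+ (λ i → sum (upper G i)) (λ i → sum (λ j → upper G j i)) ⟩
  e + sum (λ i → sum (λ j → upper G j i))              ≡⟨ cong (e +_) (∑-comm (λ i j → upper G j i)) ⟩
  e + e                                                ≡⟨ cong (e +_) (≡-sym (+-identityʳ e)) ⟩
  2 * e                                                ≡⟨ cong (2 *_) (≡-sym (edgeCount-sum G)) ⟩
  2 * edgeCount G                                      ∎
  where
  open ≡-Reasoning
  e = sum (λ i → sum (upper G i))

-- Near-regular graphs by switching

module _ (G : Graph n) {u v : Fin n} (u≢v : u ≢ v) where

  private
    hit : Fin n → Fin n → Bool
    hit i j = (does (i ≟ u) ∧ does (j ≟ v)) ∨ (does (i ≟ v) ∧ does (j ≟ u))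

    hit-sym : ∀ i j → hit i j ≡ hit j i
    hit-sym i j = trans (Bool.∨-comm (does (i ≟ u) ∧ does (j ≟ v)) _)
      (cong₂ _∨_ (Bool.∧-comm (does (i ≟ v)) (does (j ≟ u))) (Bool.∧-comm (does (i ≟ u)) (does (j ≟ v))))

    hit-irrefl : ∀ i → hit i i ≡ false
    hit-irrefl i with i ≟ u | i ≟ v
    ... | yes i≡u | yes i≡v = contradiction (trans (≡-sym i≡u) i≡v) u≢v
    ... | yes _   | no _    = refl
    ... | no _    | yes _   = refl
    ... | no _    | no _    = refl

  -- Adding and removing an edge are one operation, so that degrees are counted once for both.
  setEdge : Bool → Graph n
  setEdge b .adj i j  = if hit i j then b else adj G i j
  setEdge b .sym i j  = cong₂ (if_then b else_) (hit-sym i j) (sym G i j)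
  setEdge b .irrefl i rewrite hit-irrefl i = irrefl G i

  private
    -- The adjacency matrix of the single edge uv.
    pairs : Fin n → Fin n → ℕ
    pairs i j = δ i u * δ j v + δ i v * δ j u

    vanish : ∀ b i j → ι (adj G i j) + ι (adj G u v) * 0 ≡ ι (adj G i j) + ι b * 0
    vanish b i j = cong (ι (adj G i j) +_) (trans (*-zeroʳ (ι (adj G u v))) (≡-sym (*-zeroʳ (ι b))))

    -- The old value of the cell uv is added on the left rather than subtracted on the right, which
    -- avoids truncated subtraction.
    cell-setEdge : ∀ b i j → ι (adj (setEdge b) i j) + ι (adj G u v) * pairs i j
                             ≡ ι (adj G i j) + ι b * pairs i j
    cell-setEdge b i j with i ≟ u | j ≟ v | i ≟ v | j ≟ u
    ... | yes refl | _        | yes u≡v  | _        = contradiction u≡v u≢v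
    ... | _        | yes refl | _        | yes v≡u  = contradiction (≡-sym v≡u) u≢v
    ... | yes refl | yes refl | no _     | no _     =
      trans (cong (ι b +_) (*-identityʳ _)) (trans (+-comm (ι b) _) (cong (ι (adj G i j) +_) (≡-sym (*-identityʳ _))))
    ... | no _     | no _     | yes refl | yes refl rewrite sym G i j =
      trans (cong (ι b +_) (*-identityʳ _)) (trans (+-comm (ι b) _) (cong (ι (adj G j i) +_) (≡-sym (*-identityʳ _))))
    ... | no _     | yes _    | yes _    | no _     = vanish b i j
    ... | no _     | yes _    | no _     | no _     = vanish b i j
    ... | no _     | no _     | yes _    | no _     = vanish b i j
    ... | no _     | no _     | no _     | _        = vanish b i j
    ... | yes _    | no _     | no _     | _        = vanish b i j

    sum-pairs : ∀ i → sum (pairs i) ≡ δ i u + δ i v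
    sum-pairs i = trans (∑-distrib-+ (λ j → δ i u * δ j v) (λ j → δ i v * δ j u))
      (cong₂ _+_ (row (δ i u) v) (row (δ i v) u))
      where
      row : ∀ c w → sum (λ j → c * δ j w) ≡ c
      row c w = trans (sum-*ˡ c (λ j → δ j w)) (trans (cong (c *_) (sum-δ w)) (*-identityʳ c))

    sum-row : ∀ (H : Graph n) c i → sum (λ j → ι (adj H i j) + c * pairs i j) ≡ deg H i + c * (δ i u + δ i v)
    sum-row H c i = trans (∑-distrib-+ (λ j → ι (adj H i j)) (λ j → c * pairs i j))
      (cong₂ _+_ (≡-sym (deg-sum H i)) (trans (sum-*ˡ c (pairs i)) (cong (c *_) (sum-pairs i))))

  deg-setEdge : ∀ b i → deg (setEdge b) i + ι (adj G u v) * (δ i u + δ i v)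
                        ≡ deg G i + ι b * (δ i u + δ i v)
  deg-setEdge b i = trans (≡-sym (sum-row (setEdge b) (ι (adj G u v)) i))
    (trans (sum-cong-≗ (cell-setEdge b i)) (sum-row G (ι b) i))

  deg-addEdge : adj G u v ≡ false → ∀ i → deg (setEdge true) i ≡ deg G i + (δ i u + δ i v)
  deg-addEdge uv i = trans (≡-sym (+-identityʳ _))
    (trans (cong (λ c → deg (setEdge true) i + ι c * (δ i u + δ i v)) (≡-sym uv))
    (trans (deg-setEdge true i) (cong (deg G i +_) (*-identityˡ _))))

  deg-removeEdge : Adj G u v → ∀ i → deg (setEdge false) i + (δ i u + δ i v) ≡ deg G i
  deg-removeEdge uv i = trans (cong (deg (setEdge false) i +_) (≡-sym (*-identityˡ _)))
    (trans (cong (λ c → deg (setEdge false) i + ι c * (δ i u + δ i v)) (≡-sym uv))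
    (trans (deg-setEdge false i) (+-identityʳ _)))

  adj-setEdge : ∀ b i j → Adj (setEdge b) i j → Adj G i j ⊎ (i ≡ u × j ≡ v) ⊎ (i ≡ v × j ≡ u)
  adj-setEdge b i j a with i ≟ u | j ≟ v | i ≟ v | j ≟ u
  ... | yes i≡u | yes j≡v | _       | _       = inj₂ (inj₁ (i≡u , j≡v))
  ... | _       | _       | yes i≡v | yes j≡u = inj₂ (inj₂ (i≡v , j≡u))
  ... | yes _   | no _    | yes _   | no _    = inj₁ a
  ... | yes _   | no _    | no _    | _       = inj₁ a
  ... | no _    | _       | yes _   | no _    = inj₁ a
  ... | no _    | _       | no _    | _       = inj₁ a

  adj-removeEdge : ∀ i j → Adj (setEdge false) i j → Adj G i j
  adj-removeEdge i j a with hit i j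
  ... | false = a

-- If `u` and `v` coincide, the degree there grows by two.
Bumped : Graph n → Graph n → Fin n → Fin n → Set
Bumped G H u v = ∀ i → deg H i ≡ deg G i + (δ i u + δ i v)

-- If u and v still have room but no edge can be added at u, take a non-neighbour x of u,
-- which is then saturated, and a neighbour y of x that is neither v nor a neighbour of v,
-- and replace the edge xy by ux and vy.
switch : (G : Graph n) (k : ℕ) → k < n → {u v : Fin n} →
         (∀ i → deg G i + δ i u + δ i v ≤ k) →
         ∃ λ H → (∀ i → deg H i ≤ k) × sum (deg H) ≡ 2 + sum (deg G)
switch {n} G k k<n {u} {v} room = finish (direct (u ≟ v) (v ∈? nbrs G u))
  where
  Result : Set
  Result = ∃ λ H → ∃₂ λ u′ v′ → Bumped G H u′ v′ × (∀ i → deg G i + (δ i u′ + δ i v′) ≤ k)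

  finish : Result → ∃ λ H → (∀ i → deg H i ≤ k) × sum (deg H) ≡ 2 + sum (deg G)
  finish (H , u′ , v′ , bumped , room′) = H
    , (λ i → subst (_≤ k) (≡-sym (bumped i)) (room′ i))
    , trans (sum-cong-≗ bumped) (trans (∑-distrib-+ (deg G) (λ i → δ i u′ + δ i v′))
      (trans (cong (sum (deg G) +_) (trans (∑-distrib-+ (λ i → δ i u′) (λ i → δ i v′)) (cong₂ _+_ (sum-δ u′) (sum-δ v′))))
      (+-comm (sum (deg G)) 2)))

  room′ : ∀ i → deg G i + (δ i u + δ i v) ≤ k
  room′ i = subst (_≤ k) (+-assoc (deg G i) _ _) (room i)

  deg≤k : ∀ i → deg G i ≤ k
  deg≤k i = m+n≤o⇒m≤o _ (room′ i)

  deg-u<k : deg G u < k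
  deg-u<k = ≤-trans (≤-reflexive (trans (+-comm 1 _) (cong (deg G u +_) (≡-sym (δ-refl u))))) (m+n≤o⇒m≤o _ (room u))

  deg-v<k : deg G v < k
  deg-v<k = ≤-trans (≤-trans (≤-reflexive (trans (+-comm 1 _) (cong (deg G v +_) (≡-sym (δ-refl v)))))
                             (+-monoˡ-≤ (δ v v) (m≤m+n _ _))) (room v)

  -- These are the cases in which the edge uv cannot be added.
  module _ (u∼v : u ≡ v ⊎ Adj G u v) {x : Fin n} (x∉ : x ∉ u ∷ nbrs G u) where

    u≢x : u ≢ x
    u≢x refl = x∉ (here refl)

    ¬ux : ¬ Adj G u x
    ¬ux a = x∉ (there (∈-nbrs⁺ G a))

    add-ux : deg G x < k → Result
    add-ux x<k = setEdge G u≢x true , u , x , deg-addEdge G u≢x (Bool.¬-not ¬ux) , bound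
      where
      bound : ∀ i → deg G i + (δ i u + δ i x) ≤ k
      bound i with i ≟ u | i ≟ x
      ... | yes refl | yes refl = contradiction refl u≢x
      ... | yes refl | no _     = subst (_≤ k) (+-comm 1 (deg G i)) deg-u<k
      ... | no _     | yes refl = subst (_≤ k) (+-comm 1 (deg G i)) x<k
      ... | no _     | no _     = subst (_≤ k) (≡-sym (+-identityʳ _)) (deg≤k i)

    module _ (k≤x : k ≤ deg G x) where

      v≢x : v ≢ x
      v≢x refl = <⇒≱ deg-v<k k≤x

      pick-y : ∃ λ y → Adj G x y × y ≢ v × ¬ Adj G v y
      -- The first list is longer because deg v < k ≤ deg x. The entry `v` rules out `v` itself, and
      -- the entry `u` balances it; as `u` is `v` or adjacent to `v`, the vertex found is not `u`.
      pick-y with exists-∉ {xs = u ∷ nbrs G x} {ys = v ∷ nbrs G v}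
        (¬Any⇒All¬ _ (λ u∈ → ¬ux (Adj-sym G (∈-nbrs⁻ G u∈))) ∷ nbrs-unique G x)
        (s≤s (≤-trans deg-v<k k≤x))
      ... | y , here refl , y∉ = ⊥-elim (excl u∼v)
        where
        excl : u ≡ v ⊎ Adj G u v → ⊥
        excl (inj₁ u≡v) = y∉ (here u≡v)
        excl (inj₂ a)   = y∉ (there (∈-nbrs⁺ G (Adj-sym G a)))
      ... | y , there y∈  , y∉ = y , ∈-nbrs⁻ G y∈ , (λ y≡v → y∉ (here y≡v)) , λ a → y∉ (there (∈-nbrs⁺ G a))

      exchange : Result
      exchange with pick-y
      ... | y , xy , y≢v , ¬vy = G₃ , u , v , bumped , room′
        where
        v≢y : v ≢ y
        v≢y = y≢v ∘ ≡-sym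
        G₁ = setEdge G (Adj⇒≢ G xy) false
        G₂ = setEdge G₁ u≢x true
        G₃ = setEdge G₂ v≢y true
        -- The added edge ux could be vy only if `y` or `v` were `x`.
        ¬vy₂ : ¬ Adj G₂ v y
        ¬vy₂ a with adj-setEdge G₁ u≢x true v y a
        ... | inj₁ a₁                  = ¬vy (adj-removeEdge G (Adj⇒≢ G xy) v y a₁)
        ... | inj₂ (inj₁ (_ , y≡x))    = Adj⇒≢ G xy (≡-sym y≡x)
        ... | inj₂ (inj₂ (v≡x , _))    = v≢x v≡x
        bumped : Bumped G G₃ u v
        bumped i = begin
          deg G₃ i                                           ≡⟨ deg-addEdge G₂ v≢y (Bool.¬-not ¬vy₂) i ⟩
          deg G₂ i + (δ i v + δ i y)                         ≡⟨ cong (_+ (δ i v + δ i y)) (deg-addEdge G₁ u≢x (Bool.¬-not (¬ux ∘ adj-removeEdge G (Adj⇒≢ G xy) u x)) i) ⟩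
          deg G₁ i + (δ i u + δ i x) + (δ i v + δ i y)       ≡⟨ shuffle (deg G₁ i) (δ i u) (δ i x) (δ i v) (δ i y) ⟩
          deg G₁ i + (δ i x + δ i y) + (δ i u + δ i v)       ≡⟨ cong (_+ (δ i u + δ i v)) (deg-removeEdge G (Adj⇒≢ G xy) xy i) ⟩
          deg G i + (δ i u + δ i v)                          ∎
          where
          open ≡-Reasoning
          shuffle : ∀ d a b c e → d + (a + b) + (c + e) ≡ d + (b + e) + (a + c)
          shuffle = solve-∀

  at-u : u ≡ v ⊎ Adj G u v → Result
  -- Together `u` and its neighbours number at most k < n, so some vertex is left over.
  at-u u∼v with exists-∉ {ys = u ∷ nbrs G u} (allFin⁺ n)
    (≤-trans (s≤s deg-u<k) (subst (k <_) (≡-sym (length-tabulate id)) k<n))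
  ... | x , _ , x∉ with suc (deg G x) ≤? k
  ...   | yes x<k = add-ux u∼v x∉ x<k
  ...   | no x≮k  = exchange u∼v x∉ (≮⇒≥ x≮k)

  direct : Dec (u ≡ v) → Dec (v ∈ nbrs G u) → Result
  direct (yes u≡v) _       = at-u (inj₁ u≡v)
  direct (no _)    (yes a) = at-u (inj₂ (∈-nbrs⁻ G a))
  direct (no u≢v)  (no ¬a) =
    setEdge G u≢v true , u , v , deg-addEdge G u≢v (Bool.¬-not (¬a ∘ ∈-nbrs⁺ G)) , room′

emptyGraph : ∀ n → Graph n
emptyGraph n .adj _ _  = false
emptyGraph n .sym _ _  = refl
emptyGraph n .irrefl _ = refl

-- Starting from the empty graph, `switch` applies as long as at least two units of degree are
-- missing.
nearRegular : ∀ k n → k < n → ∃ λ (G : Graph n) → (∀ i → deg G i ≤ k) × n * k ≤ suc (sum (deg G))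
nearRegular k n k<n = grow (n * k) (emptyGraph n)
  (λ i → subst (_≤ k) (≡-sym (trans (deg-sum (emptyGraph n) i) (sum-0 n))) z≤n) (m≤m+n _ _)
  where
  -- A switch raises the degree sum by two while `fuel` drops by one, so the inequality persists; at
  -- fuel zero nothing is missing.
  grow : ∀ fuel (G : Graph n) → (∀ i → deg G i ≤ k) → n * k ≤ fuel + sum (deg G) →
         ∃ λ (H : Graph n) → (∀ i → deg H i ≤ k) × n * k ≤ suc (sum (deg H))
  grow zero       G deg≤k enough = G , deg≤k , m≤n⇒m≤1+n enough
  grow (suc fuel) G deg≤k enough with suc (suc (sum (deg G))) ≤? n * k
  ... | no  full  = G , deg≤k , ≮⇒≥ full
  ... | yes slack with sum-slack₂ deg≤k slack
  ...   | u , v , room with switch G k k<n room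
  ...     | H , deg≤k′ , sum≡ = grow fuel H deg≤k′
    (≤-trans enough (≤-trans (≤-reflexive (≡-sym (+-suc fuel _))) (+-monoʳ-≤ fuel (≤-trans (n≤1+n _) (≤-reflexive (≡-sym sum≡))))))

-- Disjoint unions

module _ {a b : ℕ} (G : Graph a) (H : Graph b) where

  private
    adj⊎ : Fin a ⊎ Fin b → Fin a ⊎ Fin b → Bool
    adj⊎ (inj₁ i) (inj₁ j) = adj G i j
    adj⊎ (inj₂ i) (inj₂ j) = adj H i j
    adj⊎ _        _        = false

    adj⊎-sym : ∀ p q → adj⊎ p q ≡ adj⊎ q p
    adj⊎-sym (inj₁ i) (inj₁ j) = sym G i j
    adj⊎-sym (inj₁ _) (inj₂ _) = refl
    adj⊎-sym (inj₂ _) (inj₁ _) = refl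
    adj⊎-sym (inj₂ i) (inj₂ j) = sym H i j

    adj⊎-irrefl : ∀ p → adj⊎ p p ≡ false
    adj⊎-irrefl (inj₁ i) = irrefl G i
    adj⊎-irrefl (inj₂ i) = irrefl H i

  _⊔_ : Graph (a + b)
  _⊔_ .adj i j  = adj⊎ (splitAt a i) (splitAt a j)
  _⊔_ .sym i j  = adj⊎-sym (splitAt a i) (splitAt a j)
  _⊔_ .irrefl i = adj⊎-irrefl (splitAt a i)

  deg-⊔ˡ : ∀ i → deg _⊔_ (i ↑ˡ b) ≡ deg G i
  deg-⊔ˡ i = trans (deg-sum _⊔_ (i ↑ˡ b)) (trans (sum-+ a b _) (trans (cong₂ _+_
    (trans (sum-cong-≗ λ j → cong ι (cong₂ adj⊎ (Fin.splitAt-↑ˡ a i b) (Fin.splitAt-↑ˡ a j b))) (≡-sym (deg-sum G i)))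
    (trans (sum-cong-≗ λ j → cong ι (cong₂ adj⊎ (Fin.splitAt-↑ˡ a i b) (Fin.splitAt-↑ʳ a b j))) (sum-0 b)))
    (+-identityʳ _)))

  deg-⊔ʳ : ∀ i → deg _⊔_ (a ↑ʳ i) ≡ deg H i
  deg-⊔ʳ i = trans (deg-sum _⊔_ (a ↑ʳ i)) (trans (sum-+ a b _) (cong₂ _+_
    (trans (sum-cong-≗ λ j → cong ι (cong₂ adj⊎ (Fin.splitAt-↑ʳ a b i) (Fin.splitAt-↑ˡ a j b))) (sum-0 a))
    (trans (sum-cong-≗ λ j → cong ι (cong₂ adj⊎ (Fin.splitAt-↑ʳ a b i) (Fin.splitAt-↑ʳ a b j))) (≡-sym (deg-sum H i)))))

  -- No edge crosses between the sides, so a walk stays in the side where it starts.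
  Connected-⊔ˡ : ∀ {x y} i → splitAt a x ≡ inj₁ i → Connected _⊔_ x y →
                 ∃ λ j → splitAt a y ≡ inj₁ j × Connected G i j
  Connected-⊔ˡ i eq here = i , eq , here
  Connected-⊔ˡ {x} i eq (step {v = v} xv vy) with splitAt a v in eq′
  ... | inj₁ j rewrite eq = let j′ , y≡ , c = Connected-⊔ˡ j eq′ vy in j′ , y≡ , step xv c
  ... | inj₂ j rewrite eq = contradiction xv λ ()

  Connected-⊔ʳ : ∀ {x y} i → splitAt a x ≡ inj₂ i → Connected _⊔_ x y →
                 ∃ λ j → splitAt a y ≡ inj₂ j × Connected H i j
  Connected-⊔ʳ i eq here = i , eq , here
  Connected-⊔ʳ {x} i eq (step {v = v} xv vy) with splitAt a v in eq′
  ... | inj₂ j rewrite eq = let j′ , y≡ , c = Connected-⊔ʳ j eq′ vy in j′ , y≡ , step xv c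
  ... | inj₁ j rewrite eq = contradiction xv λ ()

  ComponentOrder-⊔ : ∀ {c} → (∀ v → ComponentOrder≤ G v c) → (∀ v → ComponentOrder≤ H v c) →
                     ∀ v → ComponentOrder≤ _⊔_ v c
  ComponentOrder-⊔ {c} ordG ordH v m f f-inj conn with splitAt a v in eq
  ... | inj₁ i = ordG i m (λ t → proj₁ (img t)) inj (λ t → proj₂ (proj₂ (img t)))
    where
    img : ∀ t → ∃ λ j → splitAt a (f t) ≡ inj₁ j × Connected G i j
    img t = Connected-⊔ˡ i eq (conn t)
    inj : Injective _≡_ _≡_ (λ t → proj₁ (img t))
    inj {s} {t} e = f-inj (trans (≡-sym (Fin.splitAt⁻¹-↑ˡ (proj₁ (proj₂ (img s)))))
      (trans (cong (_↑ˡ b) e) (Fin.splitAt⁻¹-↑ˡ (proj₁ (proj₂ (img t))))))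
  ... | inj₂ i = ordH i m (λ t → proj₁ (img t)) inj (λ t → proj₂ (proj₂ (img t)))
    where
    img : ∀ t → ∃ λ j → splitAt a (f t) ≡ inj₂ j × Connected H i j
    img t = Connected-⊔ʳ i eq (conn t)
    inj : Injective _≡_ _≡_ (λ t → proj₁ (img t))
    inj {s} {t} e = f-inj (trans (≡-sym (Fin.splitAt⁻¹-↑ʳ (proj₁ (proj₂ (img s)))))
      (trans (cong (a ↑ʳ_) e) (Fin.splitAt⁻¹-↑ʳ (proj₁ (proj₂ (img t))))))

-- The parameter d bounds the total deficiency n k − Σ deg.
record Dense (k n d : ℕ) : Set where
  field
    graph   : Graph n
    deg≤    : ∀ i → deg graph i ≤ k
    order≤  : ∀ v → ComponentOrder≤ graph v (2 * k)
    dense   : n * k ≤ d + sum (deg graph)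
open Dense

Dense-⊔ : ∀ {k a b d e} → Dense k a d → Dense k b e → Dense k (a + b) (d + e)
Dense-⊔ {k} {a} {b} {d} {e} D E = record
  { graph  = U
  ; deg≤   = bound
  ; order≤ = ComponentOrder-⊔ (graph D) (graph E) (order≤ D) (order≤ E)
  ; dense  = begin
      (a + b) * k                                              ≡⟨ *-distribʳ-+ k a b ⟩
      a * k + b * k                                            ≤⟨ +-mono-≤ (dense D) (dense E) ⟩
      (d + sum (deg (graph D))) + (e + sum (deg (graph E)))    ≡⟨ shuffle d _ e _ ⟩
      (d + e) + (sum (deg (graph D)) + sum (deg (graph E)))    ≡⟨ cong (d + e +_) (≡-sym sum-deg) ⟩
      (d + e) + sum (deg U)                                    ∎
  }
  where
  open ≤-Reasoning
  U = graph D ⊔ graph E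
  shuffle : ∀ p q r s → (p + q) + (r + s) ≡ (p + r) + (q + s)
  shuffle = solve-∀
  sum-deg : sum (deg U) ≡ sum (deg (graph D)) + sum (deg (graph E))
  sum-deg = trans (sum-+ a b (deg U))
    (cong₂ _+_ (sum-cong-≗ (deg-⊔ˡ (graph D) (graph E))) (sum-cong-≗ (deg-⊔ʳ (graph D) (graph E))))
  bound-join : ∀ p → deg U (join a b p) ≤ k
  bound-join (inj₁ j) = subst (_≤ k) (≡-sym (deg-⊔ˡ (graph D) (graph E) j)) (deg≤ D j)
  bound-join (inj₂ j) = subst (_≤ k) (≡-sym (deg-⊔ʳ (graph D) (graph E) j)) (deg≤ E j)
  bound : ∀ i → deg U i ≤ k
  bound i = subst (λ x → deg U x ≤ k) (Fin.join-splitAt a b i) (bound-join (splitAt a i))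

-- Blocks of order between k + 1 and 2k

block : ∀ {k n} → k < n → n ≤ 2 * k → Dense k n 1
block {k} {n} k<n n≤2k = let G , deg≤k , dens = nearRegular k n k<n in record
  { graph  = G
  ; deg≤   = deg≤k
  ; order≤ = λ v m f f-inj _ → ≤-trans (Fin.injective⇒≤ f-inj) n≤2k
  ; dense  = dens
  }

even-≤ : ∀ m e → 2 * m ≤ suc (2 * e) → 2 * m ≤ 2 * e
even-≤ m e le = *-monoʳ-≤ 2 (m<1+n⇒m≤n (*-cancelˡ-< 2 m (suc e) (≤-trans (s≤s le) (≤-reflexive (≡-sym (*-suc 2 e))))))

-- The degree sum is even by the handshake lemma, so for even n k the deficiency of one left by
-- `block` cannot occur.
evenBlock : ∀ {k n} m → n * k ≡ 2 * m → k < n → n ≤ 2 * k → Dense k n 0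
evenBlock m nk≡2m k<n n≤2k = record
  { graph  = graph B
  ; deg≤   = deg≤ B
  ; order≤ = order≤ B
  ; dense  = ≤-trans (≤-reflexive nk≡2m) (≤-trans (even-≤ m (edgeCount (graph B))
      (≤-trans (≤-reflexive (≡-sym nk≡2m)) (≤-trans (dense B) (≤-reflexive (cong suc hs)))))
      (≤-reflexive (≡-sym hs)))
  }
  where
  B = block k<n n≤2k
  hs = handshake (graph B)

pronic-even : ∀ k → ∃ λ m → suc k * k ≡ 2 * m
pronic-even zero = 0 , refl
pronic-even (suc k) = let m , eq = pronic-even k in suc k + m ,
  trans (expand k) (trans (cong (2 * suc k +_) eq) (≡-sym (*-distribˡ-+ 2 (suc k) m)))
  where
  expand : ∀ k → suc (suc k) * suc k ≡ 2 * suc k + suc k * k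
  expand = solve-∀

-- n is cut into blocks of order k + 1, except that the remainder r of n modulo k + 1 is
-- absorbed into one block of order k + 1 + r ≤ 2k, or, when r = k, the last two blocks are
-- replaced by blocks of orders 2k and k + 2. Since (k + 1) k and 2k · k are even, only one
-- block can be deficient.
dense-blocks : ∀ k → 2 ≤ k → ∀ q r → r ≤ k → Dense k (r + suc (suc q) * suc k) 1
dense-blocks k 2≤k q r r≤k = subst (λ s → Dense k s 1) (arrange q r k) (go q)
  where
  arrange : ∀ q r k → q * suc k + (suc k + (suc k + r)) ≡ r + suc (suc q) * suc k
  arrange = solve-∀
  halves : ∀ k → 2 * k + (k + 2) ≡ suc k + (suc k + k)
  halves = solve-∀
  assoc-+ : ∀ q → suc k + (q * suc k + (suc k + (suc k + r))) ≡ suc q * suc k + (suc k + (suc k + r))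
  assoc-+ q = ≡-sym (+-assoc (suc k) (q * suc k) _)
  k<2k : k < 2 * k
  k<2k = subst (k <_) (cong (k +_) (≡-sym (+-identityʳ k))) (m<m+n k (≤-trans (s≤s z≤n) 2≤k))
  -- On k + 1 vertices, degrees at most `k` with no deficiency force the complete graph.
  clique : Dense k (suc k) 0
  clique = let m , eq = pronic-even k in evenBlock m eq (n<1+n k) k<2k
  last-two : Dense k (suc k + (suc k + r)) 1
  last-two with m≤n⇒m<n∨m≡n r≤k
  ... | inj₁ r<k = Dense-⊔ clique (block (s≤s (m≤m+n k r))
          (≤-trans (≤-reflexive (≡-sym (+-suc k r))) (≤-trans (+-monoʳ-≤ k r<k) (≤-reflexive (cong (k +_) (≡-sym (+-identityʳ k)))))))
  -- A single block would have order 2k + 1, which is too large. The bound k + 2 ≤ 2k fails for k =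
  -- 1.
  ... | inj₂ refl = subst (λ s → Dense k s 1) (halves k)
          (Dense-⊔ (evenBlock (k * k) (*-assoc 2 k k) k<2k ≤-refl)
                   (block (m<m+n k (s≤s z≤n)) (+-monoʳ-≤ k (≤-trans 2≤k (m≤m+n k 0)))))
  go : ∀ q → Dense k (q * suc k + (suc k + (suc k + r))) 1
  go zero    = last-two
  go (suc q) = subst (λ s → Dense k s 1) (assoc-+ q) (Dense-⊔ clique (go q))

private
  twice-suc : ∀ k → suc k + suc k ≡ 2 * k + 2
  twice-suc = solve-∀

-- As n ≥ 2(k + 1), the quotient of `n` by k + 1 is at least two, which supplies the last two
-- blocks.
dense-exists : ∀ k n → 2 ≤ k → 2 * k + 2 ≤ n → Dense k n 1
dense-exists k n 2≤k le with n / suc k | m≡m%n+[m/n]*n n (suc k) | m%n<n n (suc k)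
... | suc (suc q) | n≡ | r<  = subst (λ s → Dense k s 1) (≡-sym n≡) (dense-blocks k 2≤k q (n % suc k) (s≤s⁻¹ r<))
... | zero        | n≡ | r<  = contradiction (≤-trans le (≤-reflexive (trans n≡ (+-identityʳ _))))
        (<⇒≱ (≤-trans r< (≤-trans (m≤m+n (suc k) (suc k)) (≤-reflexive (twice-suc k)))))
... | suc zero    | n≡ | r<  = contradiction (≤-trans le (≤-reflexive (trans n≡ (cong (n % suc k +_) (*-identityˡ _)))))
        (<⇒≱ (≤-trans (+-monoˡ-< (suc k) r<) (≤-reflexive (twice-suc k))))

ComponentOrder⇒¬path : (G : Graph n) {c : ℕ} → (∀ v → ComponentOrder≤ G v c) → ¬ ContainsPath (suc c) G
ComponentOrder⇒¬path G {c} ord (p , p-inj , p-adj) = <-irrefl refl (ord (p zero) (suc c) p p-inj walk)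
  where
  walk : ∀ i → Connected G (p zero) (p i)
  walk i = go (toℕ i) i refl
    where
    snoc : ∀ {x y z} → Connected G x y → Adj G y z → Connected G x z
    snoc here         a = step a here
    snoc (step b c)   a = step b (snoc c a)
    -- `t` drives the recursion, since `inject₁ i` is not a structural part of `suc i`.
    go : ∀ t (i : Fin (suc c)) → toℕ i ≡ t → Connected G (p zero) (p i)
    go _       zero    _  = here
    go (suc t) (suc i) eq = snoc (go t (inject₁ i) (trans (Fin.toℕ-inject₁ i) (suc-injective eq)))
                                 (p-adj (inject₁ i) (suc i) (cong suc (Fin.toℕ-inject₁ i)))

-- Extending paths

-- The ends are indices, so the type tracks them through cutting and gluing. Distinctness is kept
-- apart as `Unique`, which is invariant under permutation.
data Chain (G : Graph n) : Fin n → List (Fin n) → Fin n → Set where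
  [_]   : ∀ a → Chain G a (a ∷ []) a
  _∷_   : ∀ {a b c xs} → Adj G a b → Chain G b xs c → Chain G a (a ∷ xs) c

unique-resp-↭ : {xs ys : List A} → xs ↭ ys → Unique xs → Unique ys
unique-resp-↭ {A} p = Unique-resp-↭ (setoid A) (↭⇒↭ₛ p)

module _ (G : Graph n) where

  private
    variable
      a b c d x y z : Fin n
      xs ys : List (Fin n)

  head∈ : Chain G a xs b → a ∈ xs
  head∈ [ _ ]   = here refl
  head∈ (_ ∷ _) = here refl

  last∈ : Chain G a xs b → b ∈ xs
  last∈ [ _ ]   = here refl
  last∈ (_ ∷ p) = there (last∈ p)

  chain-++ : Chain G a xs b → Adj G b c → Chain G c ys d → Chain G a (xs ++ ys) d
  chain-++ [ _ ]    bc q = bc ∷ q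
  chain-++ (ab ∷ p) bc q = ab ∷ chain-++ p bc q

  -- The new vertex list is given only up to permutation, which determines its length, members and
  -- distinctness.
  chain-reverse : Chain G a xs b → ∃ λ ys → Chain G b ys a × ys ↭ xs
  chain-reverse [ a ] = a ∷ [] , [ a ] , ↭-refl
  chain-reverse {a = a} (_∷_ {xs = xs} ab p) with chain-reverse p
  ... | ys , q , ys↭xs = ys ++ a ∷ [] , chain-++ q (Adj-sym G ab) [ a ]
        , ↭-trans (↭-sym (∷↭∷ʳ a ys)) (prep a ys↭xs)

  record Cut (a : Fin n) (xs : List (Fin n)) (b x y : Fin n) : Set where
    constructor cut
    field
      {front back} : List (Fin n)
      left  : Chain G a front x
      edge  : Adj G x y
      right : Chain G y back b
      whole : front ++ back ≡ xs

  cut-at : Chain G a xs b → x ∈ xs → x ≡ a ⊎ ∃ λ u → Cut a xs b u x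
  cut-at [ _ ]          (here x≡a) = inj₁ x≡a
  cut-at (_ ∷ _)        (here x≡a) = inj₁ x≡a
  cut-at {a = a} (ab ∷ p) (there x∈) with cut-at p x∈
  ... | inj₁ refl                   = inj₂ (a , cut [ a ] ab p refl)
  ... | inj₂ (u , cut l e r refl)   = inj₂ (u , cut (ab ∷ l) e r refl)

  -- The cycle is opened just before `x`: first the part from `x` to `b`, then the closing edge,
  -- then the part from `a`.
  rotate-cycle : Chain G a xs b → Adj G b a → x ∈ xs → ∃₂ λ ys c → Chain G x ys c × ys ↭ xs
  rotate-cycle p ba x∈ with cut-at p x∈
  ... | inj₁ refl = _ , _ , p , ↭-refl
  ... | inj₂ (u , cut {front} {back} l _ r whole) =
        back ++ front , u , chain-++ r ba l , ↭-trans (++-comm back front) (↭-reflexive whole)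

  private
    -- Arithmetic for dropping the head `a` of a path with second vertex `e` and end `b`. The terms
    -- `fa` and `gb` discount `f` at the head and `g` at the end, which cannot take part in a
    -- crossing; `ga + fe ≤ 1` says that ae is not one.
    crossing-step : ∀ L fa gb ga fe cf cg → suc L + (fa + gb) ≤ (fa + cf) + (ga + cg) → ga + fe ≤ 1 →
                    L + (fe + gb) ≤ cf + cg
    crossing-step L fa gb ga fe cf cg le small = +-cancelˡ-≤ (suc fa) _ _ (begin
      suc fa + (L + (fe + gb))         ≡⟨ lhs L fa gb fe ⟩
      suc L + (fa + gb) + fe           ≤⟨ +-monoˡ-≤ fe le ⟩
      (fa + cf) + (ga + cg) + fe       ≡⟨ mid fa cf ga cg fe ⟩
      fa + (cf + cg) + (ga + fe)       ≤⟨ +-monoʳ-≤ (fa + (cf + cg)) small ⟩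
      fa + (cf + cg) + 1               ≡⟨ +-comm (fa + (cf + cg)) 1 ⟩
      suc fa + (cf + cg)               ∎)
      where
      open ≤-Reasoning
      lhs : ∀ L fa gb fe → suc fa + (L + (fe + gb)) ≡ suc L + (fa + gb) + fe
      lhs = solve-∀
      mid : ∀ fa cf ga cg fe → (fa + cf) + (ga + cg) + fe ≡ fa + (cf + cg) + (ga + fe)
      mid = solve-∀

    not-both : ∀ p q → ¬ (p ≡ true × q ≡ true) → ι p + ι q ≤ 1
    not-both true  true  ¬both = contradiction (refl , refl) ¬both
    not-both true  false _     = ≤-refl
    not-both false true  _     = ≤-refl
    not-both false false _     = z≤n

  -- Ore's pigeonhole, with f and g the adjacency of the two ends of a path.
  crossing : (f g : Fin n → Bool) → Chain G a xs b →
             length xs + (ι (f a) + ι (g b)) ≤ count f xs + count g xs →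
             ∃₂ λ x y → Cut a xs b x y × g x ≡ true × f y ≡ true
  crossing f g [ a ] le = contradiction le (<⇒≱ (s≤s (≤-reflexive
    (cong₂ _+_ (trans (count-∷ f a []) (+-identityʳ _)) (trans (count-∷ g a []) (+-identityʳ _))))))
  crossing {b = b} f g (_∷_ {a} {e} {xs = xs} ae p) le with (g a Bool.≟ true) ×-dec (f e Bool.≟ true)
  ... | yes (ga , fe) = a , e , cut [ a ] ae p refl , ga , fe
  ... | no ¬both with crossing f g p (crossing-step (length xs) (ι (f a)) (ι (g b)) (ι (g a)) (ι (f e)) _ _
          (≤-trans le (≤-reflexive (cong₂ _+_ (count-∷ f a xs) (count-∷ g a xs)))) (not-both (g a) (f e) ¬both))
  ...   | x , y , cut l xy r refl , gx , fy = x , y , cut (ae ∷ l) xy r refl , gx , fy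

  conn-trans : Connected G x y → Connected G y z → Connected G x z
  conn-trans here         q = q
  conn-trans (step xw p)  q = step xw (conn-trans p q)

  conn-sym : Connected G x y → Connected G y x
  conn-sym here        = here
  conn-sym (step xw p) = conn-trans (conn-sym p) (step (Adj-sym G xw) here)

  -- The first step of the walk that leads out of `xs` is such an edge.
  leaving-edge : Connected G x z → x ∈ xs → z ∉ xs → ∃₂ λ x′ y → x′ ∈ xs × Adj G x′ y × y ∉ xs
  leaving-edge here x∈ z∉ = contradiction x∈ z∉
  leaving-edge {xs = xs} (step {v = w} xw p) x∈ z∉ with w ∈? xs
  ... | yes w∈ = leaving-edge p w∈ z∉
  ... | no  w∉ = _ , w , x∈ , xw , w∉

  deg≤count : (∀ {y} → y ∈ nbrs G x → y ∈ xs) → deg G x ≤ count (adj G x) xs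
  deg≤count {x = x} ⊆xs = unique-⊆-length (nbrs-unique G x)
    λ y∈ → ∈-filter⁺ (λ y → adj G x y Bool.≟ true) (⊆xs y∈) (∈-nbrs⁻ G y∈)

  -- Long paths in a component with more than 2k vertices

  module LargeComponent (v : Fin n) {k m : ℕ} (f : Fin m → Fin n) (f-inj : Injective _≡_ _≡_ f)
                        (f-conn : ∀ i → Connected G v (f i)) (2k<m : 2 * k < m) where

    record Path (t : ℕ) : Set where
      constructor path
      field
        {start end} : Fin n
        {vertices}  : List (Fin n)
        chain       : Chain G start vertices end
        unique      : Unique vertices
        within      : All (Connected G v) vertices
        order       : length vertices ≡ t
    open Path public

    rearranged : ∀ {t} (P : Path t) → Chain G a ys b → ys ↭ vertices P → Path t
    rearranged P q ys↭ = path q (unique-resp-↭ (↭-sym ys↭) (unique P)) (All-resp-↭ (↭-sym ys↭) (within P))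
      (trans (↭-length ys↭) (order P))

    reversed : ∀ {t} (P : Path t) → ∃ λ Q → start Q ≡ end P × end {t} Q ≡ start P × vertices Q ↭ vertices P
    reversed P with chain-reverse (chain P)
    ... | ys , q , ys↭ = rearranged P q ys↭ , refl , refl , ys↭

    prepend : ∀ {t} (P : Path t) → Adj G (start P) y → y ∉ vertices P → Path (suc t)
    prepend P ay y∉ = path (Adj-sym G ay ∷ chain P) (¬Any⇒All¬ _ y∉ ∷ unique P)
      (conn-trans (All.lookup (within P) (head∈ (chain P))) (step ay here) ∷ within P) (cong suc (order P))

    module _ {t : ℕ} (t≤2k : t ≤ 2 * k) where

      -- Some `f i` is off the cycle because t ≤ 2k < m, so by connectedness an edge xy leaves the
      -- cycle. Opening the cycle at `x` gives a path to which `y` can be prepended.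
      extend-cycle : (P : Path t) → Adj G (end P) (start P) → Path (suc t)
      extend-cycle P ba with exists-∉ {xs = tabulate f} {ys = vertices P} (tabulate⁺ f-inj)
        (subst₂ _<_ (≡-sym (order P)) (≡-sym (length-tabulate f)) (≤-<-trans t≤2k 2k<m))
      ... | z , z∈ , z∉ with ∈-tabulate⁻ {f = f} z∈
      ...   | i , refl with leaving-edge
                (conn-trans (conn-sym (All.lookup (within P) (head∈ (chain P)))) (f-conn i)) (head∈ (chain P)) z∉
      ...     | x , y , x∈ , xy , y∉ with rotate-cycle (chain P) ba x∈
      ...       | ys , c , q , ys↭ = prepend (rearranged P q ys↭) xy (y∉ ∘ ∈-resp-↭ ys↭)

      -- Ore's argument: a crossing is an edge xy of the path with x adjacent to the end b and y to
      -- the start a. Going from a to x, then from b back to y, and closing with ya gives a cycle.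
      extend-closed : (P : Path t) → (∀ {y} → y ∈ nbrs G (start P) → y ∈ vertices P) →
                      (∀ {y} → y ∈ nbrs G (end P) → y ∈ vertices P) →
                      t ≤ deg G (start P) + deg G (end P) → Path (suc t)
      extend-closed P a⊆ b⊆ t≤ with crossing (adj G (start P)) (adj G (end P)) (chain P)
        -- The discounted terms vanish, as no vertex is adjacent to itself.
        (≤-trans (≤-reflexive (trans (cong (λ s → length (vertices P) + s)
                   (cong₂ (λ p q → ι p + ι q) (irrefl G (start P)) (irrefl G (end P))))
                   (trans (+-identityʳ _) (order P))))
                 (≤-trans t≤ (+-mono-≤ (deg≤count a⊆) (deg≤count b⊆))))
      ... | x , y , cut {front} l _ r whole , bx , ay with chain-reverse r
      ...   | ys , q , ys↭ = extend-cycle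
              (rearranged P (chain-++ l (Adj-sym G bx) q) (↭-trans (++⁺ˡ front ys↭) (↭-reflexive whole)))
              (Adj-sym G ay)

      -- Either an end has a neighbour off the path, which extends it at once, or `extend-closed`
      -- applies.
      extend-ore : (P : Path t) → t ≤ deg G (start P) + deg G (end P) → Path (suc t)
      extend-ore P t≤ with ∈-or-∉ (nbrs G (start P)) (vertices P) | ∈-or-∉ (nbrs G (end P)) (vertices P)
      ... | inj₁ (y , y∈ , y∉) | _ = prepend P (∈-nbrs⁻ G y∈) y∉
      ... | inj₂ _ | inj₁ (y , y∈ , y∉) with reversed P
      ...   | Q , refl , _ , Q↭ = prepend Q (∈-nbrs⁻ G y∈) (y∉ ∘ ∈-resp-↭ Q↭)
      extend-ore P t≤ | inj₂ a⊆ | inj₂ b⊆ = extend-closed P a⊆ b⊆ t≤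

      -- Rotating at a neighbour of the start w other than its successor moves w to the interior.
      extend-or-rotate : (P : Path t) → 2 ≤ deg G (start P) →
                         Path (suc t) ⊎ ∃ λ (Q : Path t) → start Q ≢ start P × end Q ≢ start P
      extend-or-rotate P 2≤deg with ∈-or-∉ (nbrs G (start P)) (vertices P)
      ... | inj₁ (y , y∈ , y∉) = inj₁ (prepend P (∈-nbrs⁻ G y∈) y∉)
      extend-or-rotate P@(path [ w ] _ _ _) 2≤deg | inj₂ w⊆
        with exists-∉ {ys = []} (nbrs-unique G w) (≤-trans (s≤s z≤n) 2≤deg)
      ... | y , y∈ , _ with w⊆ y∈
      ...   | here refl = contradiction refl (Adj⇒≢ G (∈-nbrs⁻ G y∈))
      extend-or-rotate P@(path (_∷_ {w} {e} we p) (w∉ ∷ _) _ _) 2≤deg | inj₂ w⊆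
        -- Degree two provides a neighbour `y` of `w` other than the successor `e`.
        with exists-∉ {ys = e ∷ []} (nbrs-unique G w) 2≤deg
      ... | y , y∈ , y∉ with w⊆ y∈
      ...   | here refl = contradiction refl (Adj⇒≢ G (∈-nbrs⁻ G y∈))
      ...   | there y∈′ with cut-at p y∈′
      ...     | inj₁ refl = contradiction (here refl) y∉
      -- The new path runs from `u`, the vertex before `y`, back to `w`, jumps to `y` and continues
      -- to the old end.
      ...     | inj₂ (u , cut {front} {back} l _ r refl) with chain-reverse (we ∷ l)
      ...       | ys , q , ys↭ = inj₂
                  ( rearranged P (chain-++ q (∈-nbrs⁻ G y∈) r) (++⁺ʳ back ys↭)
                  , (λ u≡w → All.lookup w∉ (∈-++⁺ˡ (last∈ l)) (≡-sym u≡w))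
                  , (λ b≡w → All.lookup w∉ (last∈ p) (≡-sym b≡w)))

    -- One exceptional vertex is allowed; its two neighbours are what the rotation needs.
    AlmostDegree≥k : Set
    AlmostDegree≥k = (∀ u → Connected G v u → k ≤ deg G u)
      ⊎ ∃ λ w → 2 ≤ deg G w × (∀ u → Connected G v u → u ≢ w → k ≤ deg G u)

    extend : ∀ {t} → AlmostDegree≥k → t ≤ 2 * k → Path t → Path (suc t)
    extend {t} hyp t≤2k P = by-degree hyp
      where
      ore : (Q : Path t) → k ≤ deg G (start Q) → k ≤ deg G (end Q) → Path (suc t)
      ore Q k≤a k≤b = extend-ore t≤2k Q (≤-trans t≤2k (≤-trans (≤-reflexive (cong (k +_) (+-identityʳ k))) (+-mono-≤ k≤a k≤b)))
      start-conn : (Q : Path t) → Connected G v (start Q)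
      start-conn Q = All.lookup (within Q) (head∈ (chain Q))
      end-conn : (Q : Path t) → Connected G v (end Q)
      end-conn Q = All.lookup (within Q) (last∈ (chain Q))
      module _ {w : Fin n} (2≤deg : 2 ≤ deg G w) (others : ∀ u → Connected G v u → u ≢ w → k ≤ deg G u) where
        ore-≢ : (Q : Path t) → start Q ≢ w → end Q ≢ w → Path (suc t)
        ore-≢ Q a≢w b≢w = ore Q (others _ (start-conn Q) a≢w) (others _ (end-conn Q) b≢w)
        from-w : (Q : Path t) → start Q ≡ w → Path (suc t)
        from-w Q refl with extend-or-rotate t≤2k Q 2≤deg
        ... | inj₁ R                 = R
        ... | inj₂ (R , a≢w , b≢w)   = ore-≢ R a≢w b≢w
      by-degree : AlmostDegree≥k → Path (suc t)
      by-degree (inj₁ all≥) = ore P (all≥ _ (start-conn P)) (all≥ _ (end-conn P))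
      by-degree (inj₂ (w , 2≤deg , others)) with start P ≟ w | end P ≟ w
      ... | yes a≡w | _       = from-w 2≤deg others P a≡w
      ... | no a≢w  | no b≢w  = ore-≢ 2≤deg others P a≢w b≢w
      ... | no _    | yes b≡w = let Q , a≡ , _ = reversed P in from-w 2≤deg others Q (trans a≡ b≡w)

    long-path : AlmostDegree≥k → ∀ t → t ≤ 2 * k → Path (suc t)
    long-path hyp zero    _   = path [ v ] ([] ∷ []) (here ∷ []) refl
    long-path hyp (suc t) t<2k = extend hyp t<2k (long-path hyp t (<⇒≤ t<2k))

  chain⇒path : Chain G a xs b → Unique xs → ContainsPath (length xs) G
  chain⇒path {xs = xs} p xs! = lookup xs , lookup-injective xs! , steps p
    where
    first : Chain G c ys d → (j : Fin (length ys)) → 0 ≡ toℕ j → lookup ys j ≡ c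
    first [ _ ]   zero _ = refl
    first (_ ∷ _) zero _ = refl
    steps : Chain G c ys d → (i j : Fin (length ys)) → suc (toℕ i) ≡ toℕ j → Adj G (lookup ys i) (lookup ys j)
    steps [ _ ]    zero    zero    ()
    steps (ab ∷ p) zero    (suc j) eq = trans (cong (adj G _) (first p j (suc-injective eq))) ab
    steps (ab ∷ p) (suc i) (suc j) eq = steps p i j (suc-injective eq)

-- Extremal graphs

dense-free : ∀ {k n d} (D : Dense k n d) → Free k (graph D)
dense-free D = deg≤⇒¬star (graph D) _ (deg≤ D) , ComponentOrder⇒¬path (graph D) (order≤ D)

-- The graph from `dense-exists` is free, so `G` has at least as many edges.
extremal-dense : ∀ k n → 2 ≤ k → 2 * k + 2 ≤ n → (G : Graph n) → Extremal k G →
                 n * k ≤ suc (2 * edgeCount G)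
extremal-dense k n 2≤k le G (_ , maximal) = begin
  n * k                           ≤⟨ dense D ⟩
  suc (sum (deg (graph D)))       ≡⟨ cong suc (handshake (graph D)) ⟩
  suc (2 * edgeCount (graph D))   ≤⟨ s≤s (*-monoʳ-≤ 2 (maximal (graph D) (dense-free D))) ⟩
  suc (2 * edgeCount G)           ∎
  where
  open ≤-Reasoning
  D = dense-exists k n 2≤k le

-- A walk from `u` to a second vertex of its component has to leave `u`.
component-deg≥1 : (G : Graph n) {m : ℕ} (f : Fin m → Fin n) → Injective _≡_ _≡_ f → 2 ≤ m →
                  ∀ u → (∀ i → Connected G u (f i)) → 1 ≤ deg G u
component-deg≥1 G f f-inj 2≤m u u-conn
  with exists-∉ {ys = u ∷ []} (tabulate⁺ f-inj) (subst (2 ≤_) (≡-sym (length-tabulate f)) 2≤m)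
... | z , z∈ , z∉ with ∈-tabulate⁻ {f = f} z∈
...   | i , refl with leaving-edge G (u-conn i) (here refl) z∉
...     | _ , _ , here refl , uy , _ = ∈-length (∈-nbrs⁺ G uy)

extremal-degrees : ∀ k n → 2 ≤ k → 2 * k + 2 ≤ n → (G : Graph n) → Extremal k G →
  (∀ u → k ≤ deg G u) ⊎ ∃ λ w → 2 ≤ deg G w × (∀ u → u ≢ w → k ≤ deg G u)
extremal-degrees k n 2≤k le G ext@((¬star , _) , _) with n * k ≤? sum (deg G)
... | yes full = inj₁ (sum-max (¬star⇒deg≤ G k ¬star) full)
... | no  lack with sum-slack (¬star⇒deg≤ G k ¬star) (≰⇒> lack)
...   | w , deg+δ≤k = inj₂ (w , deg-w , others)
  where
  almost : n * k ≤ suc (2 * edgeCount G)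
  almost = extremal-dense k n 2≤k le G ext
  -- One extra unit at `w` brings the total up to at least n k, so `sum-max` applies to the bumped
  -- degrees.
  k≤deg+δ : ∀ i → k ≤ deg G i + δ i w
  k≤deg+δ = sum-max deg+δ≤k (≤-trans almost
    (≤-reflexive (trans (cong suc (≡-sym (handshake G))) (≡-sym (sum-bump (¬star⇒deg≤ G k ¬star) w)))))
  -- For k = 2 both n k and the degree sum are even, so a deficiency of exactly one is impossible.
  2≢k : 2 ≢ k
  2≢k refl = lack (≤-trans (≤-reflexive (*-comm n 2)) (≤-trans
    (even-≤ n (edgeCount G) (≤-trans (≤-reflexive (*-comm 2 n)) almost)) (≤-reflexive (≡-sym (handshake G)))))
  -- Hence k ≥ 3, and `w` has degree at least k - 1.
  deg-w : 2 ≤ deg G w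
  deg-w = s≤s⁻¹ (≤-trans (≤∧≢⇒< 2≤k 2≢k) (≤-trans (k≤deg+δ w)
    (≤-reflexive (trans (cong (deg G w +_) (δ-refl w)) (+-comm (deg G w) 1)))))
  others : ∀ u → u ≢ w → k ≤ deg G u
  others u u≢w = ≤-trans (k≤deg+δ u) (≤-reflexive (trans (cong (deg G u +_) (δ-≢ u≢w)) (+-identityʳ _)))

theorem3p5 : (k n : ℕ) → 1 ≤ k → 2 * k + 2 ≤ n →
    (G : Graph n) → Extremal k G →
    ∀ (v : Fin n) → ComponentOrder≤ G v (2 * k)
theorem3p5 k n 1≤k le G ext@((_ , ¬path) , _) v m f f-inj f-conn = ≮⇒≥ λ 2k<m →
  let open LargeComponent G v {k} f f-inj f-conn 2k<m
      P = long-path (degrees 2k<m (m≤n⇒m<n∨m≡n 1≤k)) (2 * k) ≤-refl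
  in ¬path (subst (λ l → ContainsPath l G) (order P) (chain⇒path G (chain P) (unique P)))
  where
  degrees : (2k<m : 2 * k < m) → 1 < k ⊎ 1 ≡ k →
            LargeComponent.AlmostDegree≥k G v {k} f f-inj f-conn 2k<m
  -- For k = 1 only positive degrees are required, and these come from the component having a second
  -- vertex.
  degrees 2k<m (inj₂ refl) = inj₁ λ u vu →
    component-deg≥1 G f f-inj (<⇒≤ 2k<m) u (λ i → conn-trans G (conn-sym G vu) (f-conn i))
  degrees _ (inj₁ 2≤k) with extremal-degrees k n 2≤k le G ext
  ... | inj₁ all≥               = inj₁ λ u _ → all≥ u
  ... | inj₂ (w , 2≤deg , rest) = inj₂ (w , 2≤deg , λ u _ → rest u)
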